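{- Let $T$ be an h-inductive theory in a first-order language $L$. If the class of h-maximal models of $T$ is elementary and has the amalgamation property, then $T$ is Hausdorff.
   Context: Let $L$ be a first-order language with equality. A positive formula is one obtained from atomic formulas (including falsity $\bot$) using $\exists,\vee,\wedge$. An h-inductive sentence is a finite conjunction of sentences $\forall\bar x(\exists\bar y\,\varphi(\bar x,\bar y)\rightarrow\exists\bar z\,\psi(\bar x,\bar z))$ with $\varphi,\psi$ quantifier-free positive. An h-inductive theory is a theory axiomatized by h-inductive sentences. A homomorphism $f:A\to B$ of $L$-structures is a map such that $A\models\phi(\bar a)$ implies $B\models\phi(f(\bar a))$ for every atomic $\phi$ and tuple $\bar a$ of $A$; it is an embedding if $\bar a$ and $f(\bar a)$ satisfy the same atomic formulas for every tuple $\bar a$ of $A$. A model $M$ of $T$ is h-maximal if every homomorphism from $M$ into a model of $T$ is an embedding. A class of $L$-structures is elementary if it is the class of models of a set of first-order $L$-sentences. A class $\Gamma$ has the amalgamation property if for all $A,B,C\in\Gamma$ and homomorphisms $f:A\to B$, $g:A\to C$ there are $D\in\Gamma$ and homomorphisms $g':B\to D$, $f':C\to D$ with $g'\circ f=f'\circ g$. An $n$-type of $T$ is a maximal set of positive formulas in $n$ fixed variables consistent with $T$; $S_n(T)$ is the set of $n$-types, topologized by taking the sets $F_\varphi=\{p\in S_n(T): \varphi\in p\}$, $\varphi$ a positive formula in these variables, as a basis of closed sets. $T$ is Hausdorff if $S_n(T)$ is a Hausdorff space for every natural number $n$. -}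

module Defs where

open import Axiom.ExcludedMiddle using (ExcludedMiddle)
open import Data.Empty.Polymorphic using (⊥)
open import Data.Fin using (Fin)
open import Data.Nat using (ℕ; zero; suc; _+_)
open import Data.Product using (Σ; ∃; _×_; proj₁)
open import Data.Sum using (_⊎_)
open import Data.Vec using (Vec; []; _∷_; lookup; map)
open import Data.Vec.Relation.Binary.Pointwise.Inductive using (Pointwise)
open import Function.Bundles using (_⇔_)
open import Level using (Setω) renaming (suc to lsuc)
open import Relation.Binary.Bundles using (Poset; Setoid)
open import Relation.Nullary using (¬_)
open import Relation.Unary using (Pred; _∈_; _⊆_; _≐_; _∩_; ∁; Empty)

-- The classical metatheory, as a hypothesis: excluded middle, and choice in
-- the form of Zorn's lemma.

module _ {c ℓ₁ ℓ₂} (P : Poset c ℓ₁ ℓ₂) where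
  open Poset P

  IsChain : ∀ {ℓ} → Pred Carrier ℓ → Set _
  IsChain C = ∀ {x y} → x ∈ C → y ∈ C → x ≤ y ⊎ y ≤ x

  UpperBound : ∀ {ℓ} → Pred Carrier ℓ → Pred Carrier _
  UpperBound C u = ∀ {x} → x ∈ C → x ≤ u

  MaximalElement : Pred Carrier _
  MaximalElement m = ∀ {x} → m ≤ x → x ≈ m

ZornsLemma : ∀ c ℓ₁ ℓ₂ ℓ → Set _
ZornsLemma c ℓ₁ ℓ₂ ℓ = (P : Poset c ℓ₁ ℓ₂) →
  ((C : Pred (Poset.Carrier P) ℓ) → IsChain P C → ∃ (UpperBound P C)) →
  ∃ (MaximalElement P)

record Classical : Setω where
  field
    excludedMiddle : ∀ {ℓ} → ExcludedMiddle ℓ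
    zorn           : ∀ {c ℓ₁ ℓ₂ ℓ} → ZornsLemma c ℓ₁ ℓ₂ ℓ

record Language ℓ : Set (lsuc ℓ) where
  field
    Func : ℕ → Set ℓ
    Rel  : ℕ → Set ℓ

open Language

module _ {ℓ} (L : Language ℓ) where

  infix  8 _==_
  infixr 6 _∧_
  infixr 5 _∨_
  infixr 4 _⇒_

  data Term (n : ℕ) : Set ℓ where
    var : Fin n → Term n
    app : ∀ {k} → Func L k → Vec (Term n) k → Term n

  -- Formula n has its free variables among n de Bruijn indices; under a
  -- quantifier, index 0 is the bound variable.
  data Formula (n : ℕ) : Set ℓ where
    _==_        : Term n → Term n → Formula n
    rel         : ∀ {k} → Rel L k → Vec (Term n) k → Formula n
    ⊥′          : Formula n
    _∧_ _∨_ _⇒_ : Formula n → Formula n → Formula n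
    ∀′ ∃′       : Formula (suc n) → Formula n

  Sentence : Set ℓ
  Sentence = Formula 0

  Theory : Set (lsuc ℓ)
  Theory = Pred Sentence ℓ

  -- Agda has no quotient types, so the equality of a structure is an
  -- equivalence relation respected by all the symbols.
  record Structure : Set (lsuc ℓ) where
    field
      domain   : Setoid ℓ ℓ
    open Setoid domain public using (Carrier; _≈_)
    field
      nonempty : Carrier
      ⟦_⟧ᶠ     : ∀ {k} → Func L k → Vec Carrier k → Carrier
      ⟦_⟧ʳ     : ∀ {k} → Rel L k → Pred (Vec Carrier k) ℓ
      func-cong : ∀ {k} (f : Func L k) {xs ys} →
                  Pointwise _≈_ xs ys → ⟦ f ⟧ᶠ xs ≈ ⟦ f ⟧ᶠ ys
      rel-resp  : ∀ {k} (R : Rel L k) {xs ys} →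
                  Pointwise _≈_ xs ys → ⟦ R ⟧ʳ xs → ⟦ R ⟧ʳ ys

open Structure using (Carrier)

module _ {ℓ} {L : Language ℓ} where

  infix  8 _==_
  infixr 6 _∧_
  infixr 5 _∨_
  infixr 4 _⇒_

  module _ (M : Structure L) where
    open Structure M using (_≈_; ⟦_⟧ᶠ; ⟦_⟧ʳ)

    mutual
      eval : ∀ {n} → Term L n → Vec (Carrier M) n → Carrier M
      eval (var i)    a = lookup a i
      eval (app f ts) a = ⟦ f ⟧ᶠ (evals ts a)

      evals : ∀ {n k} → Vec (Term L n) k → Vec (Carrier M) n → Vec (Carrier M) k
      evals []       a = []
      evals (t ∷ ts) a = eval t a ∷ evals ts a

    infix 3 _⊨_[_] _⊨_

    _⊨_[_] : ∀ {n} → Formula L n → Vec (Carrier M) n → Set ℓ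
    _⊨_[_] (s == t)   a = eval s a ≈ eval t a
    _⊨_[_] (rel R ts) a = ⟦ R ⟧ʳ (evals ts a)
    _⊨_[_] ⊥′         a = ⊥
    _⊨_[_] (φ ∧ ψ)    a = _⊨_[_] φ a × _⊨_[_] ψ a
    _⊨_[_] (φ ∨ ψ)    a = _⊨_[_] φ a ⊎ _⊨_[_] ψ a
    _⊨_[_] (φ ⇒ ψ)    a = _⊨_[_] φ a → _⊨_[_] ψ a
    _⊨_[_] (∀′ φ)     a = (x : Carrier M) → _⊨_[_] φ (x ∷ a)
    _⊨_[_] (∃′ φ)     a = Σ (Carrier M) λ x → _⊨_[_] φ (x ∷ a)

    _⊨_ : Theory L → Set ℓ
    _⊨_ T = ∀ {σ} → σ ∈ T → _⊨_[_] σ []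

  data Atomic {n} : Formula L n → Set ℓ where
    _==_ : ∀ s t → Atomic (s == t)
    rel  : ∀ {k} (R : Rel L k) ts → Atomic (rel R ts)
    ⊥′   : Atomic ⊥′

  data Positive : ∀ {n} → Formula L n → Set ℓ where
    atomic : ∀ {n} {φ : Formula L n} → Atomic φ → Positive φ
    _∧_    : ∀ {n} {φ ψ : Formula L n} → Positive φ → Positive ψ → Positive (φ ∧ ψ)
    _∨_    : ∀ {n} {φ ψ : Formula L n} → Positive φ → Positive ψ → Positive (φ ∨ ψ)
    ∃′     : ∀ {n} {φ : Formula L (suc n)} → Positive φ → Positive (∃′ φ)

  data QuantifierFree {n} : Formula L n → Set ℓ where
    atomic : ∀ {φ} → Atomic φ → QuantifierFree φ
    _∧_    : ∀ {φ ψ} → QuantifierFree φ → QuantifierFree ψ → QuantifierFree (φ ∧ ψ)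
    _∨_    : ∀ {φ ψ} → QuantifierFree φ → QuantifierFree ψ → QuantifierFree (φ ∨ ψ)
    _⇒_    : ∀ {φ ψ} → QuantifierFree φ → QuantifierFree ψ → QuantifierFree (φ ⇒ ψ)

  ∀* : ∀ n → Formula L n → Sentence L
  ∀* zero    φ = φ
  ∀* (suc n) φ = ∀* n (∀′ φ)

  ∃* : ∀ m {n} → Formula L (m + n) → Formula L n
  ∃* zero    φ = φ
  ∃* (suc m) φ = ∃* m (∃′ φ)

  data HInductive : Sentence L → Set ℓ where
    implication : ∀ n m k {φ : Formula L (m + n)} {ψ : Formula L (k + n)} →
                  Positive φ → QuantifierFree φ →
                  Positive ψ → QuantifierFree ψ →
                  HInductive (∀* n (∃* m φ ⇒ ∃* k ψ))
    _∧_         : ∀ {σ τ} → HInductive σ → HInductive τ → HInductive (σ ∧ τ)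

  HInductiveTheory : Pred (Theory L) (lsuc ℓ)
  HInductiveTheory T =
    Σ (Theory L) λ H → H ⊆ HInductive × (∀ M → (M ⊨ T) ⇔ (M ⊨ H))

  record Hom (A B : Structure L) : Set ℓ where
    field
      fun       : Carrier A → Carrier B
      preserves : ∀ {n} {φ : Formula L n} → Atomic φ → ∀ a →
                  A ⊨ φ [ a ] → B ⊨ φ [ map fun a ]

  open Hom public

  IsEmbedding : ∀ {A B} → Pred (Hom A B) ℓ
  IsEmbedding {A} {B} f = ∀ {n} {φ : Formula L n} → Atomic φ → ∀ a →
    (A ⊨ φ [ a ]) ⇔ (B ⊨ φ [ map (fun f) a ])

  HMaximal : Theory L → Pred (Structure L) (lsuc ℓ)
  HMaximal T M = M ⊨ T × (∀ N → N ⊨ T → (f : Hom M N) → IsEmbedding f)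

  Elementary : ∀ {ℓ′} → Pred (Structure L) ℓ′ → Set _
  Elementary Γ = Σ (Theory L) λ Θ → ∀ M → M ∈ Γ ⇔ (M ⊨ Θ)

  AmalgamationProperty : ∀ {ℓ′} → Pred (Structure L) ℓ′ → Set _
  AmalgamationProperty Γ =
    ∀ {A B C} → A ∈ Γ → B ∈ Γ → C ∈ Γ → (f : Hom A B) (g : Hom A C) →
    Σ (Structure L) λ D → D ∈ Γ × Σ (Hom B D) λ g′ → Σ (Hom C D) λ f′ →
      ∀ x → Structure._≈_ D (fun g′ (fun f x)) (fun f′ (fun g x))

module _ {ℓ} (L : Language ℓ) where

  PositiveFormula : ℕ → Set ℓ
  PositiveFormula n = Σ (Formula L n) Positive

module _ {ℓ} {L : Language ℓ} (T : Theory L) where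

  Consistent : ∀ {n} → Pred (Pred (PositiveFormula L n) ℓ) (lsuc ℓ)
  Consistent {n} p = Σ (Structure L) λ M → M ⊨ T × Σ (Vec (Carrier M) n) λ a →
    ∀ {φ} → φ ∈ p → M ⊨ proj₁ φ [ a ]

  -- S n is the set of n-types; its equality is _≐_ of the underlying sets.
  record S (n : ℕ) : Set (lsuc ℓ) where
    field
      formulas   : Pred (PositiveFormula L n) ℓ
      consistent : Consistent formulas
      maximal    : ∀ q → Consistent q → formulas ⊆ q → q ⊆ formulas

  open S

  F : ∀ {n} → PositiveFormula L n → Pred (S n) ℓ
  F φ p = φ ∈ formulas p

  -- The sets F φ are a basis: the closed sets are their intersections.
  Closed : ∀ {n} → Pred (Pred (S n) ℓ) (lsuc ℓ)
  Closed {n} C = Σ (Pred (PositiveFormula L n) ℓ) λ Φ →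
    C ≐ λ p → ∀ {φ} → φ ∈ Φ → p ∈ F φ

  Open : ∀ {n} → Pred (Pred (S n) ℓ) (lsuc ℓ)
  Open {n} U = Σ (Pred (S n) ℓ) λ C → Closed C × U ≐ ∁ C

  HausdorffSpace : ℕ → Set (lsuc ℓ)
  HausdorffSpace n = ∀ (p q : S n) → ¬ (formulas p ≐ formulas q) →
    Σ (Pred (S n) ℓ) λ U → Σ (Pred (S n) ℓ) λ V →
      Open U × Open V × p ∈ U × q ∈ V × Empty (U ∩ V)

  Hausdorff : Set (lsuc ℓ)
  Hausdorff = ∀ n → HausdorffSpace n

{-# OPTIONS --safe #-}

-- Let p and q be types that no two positive formulas separate.  By compactness,
-- applied to the axioms of the h-maximal models, some h-maximal model M has a
-- tuple a all of whose positive formulas lie in both p and q.  By compactness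
-- again, M maps to a model of T in which the image of a satisfies p, and to one
-- in which it satisfies q; both may be taken h-maximal.  In an amalgam of the two
-- over M the image of a satisfies p and q, which are therefore equal by maximality.

module Submission where

open import Defs
open import Data.Empty using (⊥-elim)
import Data.Empty.Polymorphic as Polymorphic
open import Data.Fin using (Fin; zero; suc; _↑ˡ_; _↑ʳ_)
open import Data.List using (List; []; _∷_; filter; concatMap) renaming (_++_ to _++ₗ_)
import Data.List.Membership.Propositional as List
open import Data.List.Membership.Propositional.Properties
  using (∈-++⁺ˡ; ∈-++⁺ʳ; ∈-concatMap⁺; ∈-filter⁺; ∈-filter⁻)
open import Data.List.Relation.Unary.Any using (here; there)
open import Data.List.Relation.Unary.All as ListAll using ([]; _∷_)
open import Data.Nat using (ℕ; zero; suc; _+_)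
open import Data.Product using (Σ; ∃; _×_; _,_; proj₁; proj₂)
open import Data.Sum using (_⊎_; inj₁; inj₂; [_,_])
import Data.Sum as Sum
open import Data.Unit.Polymorphic using (⊤)
open import Data.Vec using (Vec; []; _∷_; lookup; map; _++_; tabulate; toList)
open import Data.Vec.Membership.Propositional.Properties using (∈-lookup; ∈-toList⁺)
open import Data.Vec.Properties
  using (map-∘; map-id; lookup-map; lookup-++ˡ; lookup-++ʳ;
         tabulate-∘; tabulate-cong; tabulate∘lookup)
open import Data.Vec.Relation.Binary.Pointwise.Inductive as Pointwise using (Pointwise; []; _∷_)
open import Data.Vec.Relation.Unary.All as All using (All; []; _∷_)
open import Function using (_∘_; id; const)
open import Function.Bundles using (_⇔_; mk⇔; Equivalence)
open import Level using (Lift; lift; lower) renaming (suc to lsuc)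
open import Relation.Binary.Bundles using (Poset; Setoid)
import Relation.Binary.Construct.On as On
open import Relation.Binary.PropositionalEquality
  using (_≡_; refl; sym; trans; cong; cong₂; subst; subst₂)
open import Relation.Nullary using (¬_; Dec; yes; no)
open import Relation.Nullary.Decidable using (True; toWitness; fromWitness)
open import Relation.Unary using (Pred; _∈_; _∉_; _⊆_; _≐_; _∩_; ∁; Empty)
open import Relation.Unary.Relation.Binary.Subset using (⊆-poset)

open Structure using (Carrier; nonempty)
open Equivalence using (to; from)

-- The conditions on the tuple in `M` are negative: it must omit every positive formula missing from
-- `p` or from `q`. Homomorphisms do not preserve omission, so a model of `T` with such a tuple
-- could not simply be extended to an h-maximal one, whereas amalgamation needs an h-maximal base.
-- Elementarity bridges this gap: compactness is applied over first-order axioms of the h-maximal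
-- models. Finitely many of the conditions reduce to one formula missing from `p` and one missing
-- from `q`. Inseparability gives a type `r` missing both, and a type, being maximal, gains no
-- positive formula when its realization is mapped into an h-maximal model.

map-tabulate : ∀ {a b} {A : Set a} {B : Set b} {n} (f : A → B) (g : Fin n → A) {xs : Vec B n} →
               (∀ i → f (g i) ≡ lookup xs i) → map f (tabulate g) ≡ xs
map-tabulate f g {xs} h =
  trans (sym (tabulate-∘ f g)) (trans (tabulate-cong h) (tabulate∘lookup xs))

-- Satisfaction, positive formulas and immersions.

module _ {ℓ} {L : Language ℓ} where

  module _ (M : Structure L) where
    open Structure M using (_≈_; domain; func-cong; rel-resp)
    private module ≈ = Setoid domain

    mutual
      eval-cong : ∀ {n} (t : Term L n) {a b} → Pointwise _≈_ a b → eval M t a ≈ eval M t b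
      eval-cong (var i)    ab = Pointwise.lookup ab i
      eval-cong (app f ts) ab = func-cong f (evals-cong ts ab)

      evals-cong : ∀ {n k} (ts : Vec (Term L n) k) {a b} → Pointwise _≈_ a b →
                   Pointwise _≈_ (evals M ts a) (evals M ts b)
      evals-cong []       ab = []
      evals-cong (t ∷ ts) ab = eval-cong t ab ∷ evals-cong ts ab

    ⊨-resp : ∀ {n} (φ : Formula L n) {a b} → Pointwise _≈_ a b → M ⊨ φ [ a ] → M ⊨ φ [ b ]
    ⊨-resp (s == t)   ab h = ≈.trans (≈.sym (eval-cong s ab)) (≈.trans h (eval-cong t ab))
    ⊨-resp (rel R ts) ab h = rel-resp R (evals-cong ts ab) h
    ⊨-resp (φ ∧ ψ)    ab (h , h′) = ⊨-resp φ ab h , ⊨-resp ψ ab h′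
    ⊨-resp (φ ∨ ψ)    ab h = Sum.map (⊨-resp φ ab) (⊨-resp ψ ab) h
    ⊨-resp (φ ⇒ ψ)    ab h = ⊨-resp ψ ab ∘ h ∘ ⊨-resp φ (Pointwise.sym ≈.sym ab)
    ⊨-resp (∀′ φ)     ab h x = ⊨-resp φ (≈.refl ∷ ab) (h x)
    ⊨-resp (∃′ φ)     ab (x , h) = x , ⊨-resp φ (≈.refl ∷ ab) h

    ∀*⁺ : ∀ n {φ : Formula L n} → (∀ a → M ⊨ φ [ a ]) → M ⊨ ∀* n φ [ [] ]
    ∀*⁺ zero    h = h []
    ∀*⁺ (suc n) h = ∀*⁺ n λ a x → h (x ∷ a)

    ∀*⁻ : ∀ n {φ : Formula L n} → M ⊨ ∀* n φ [ [] ] → ∀ a → M ⊨ φ [ a ]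
    ∀*⁻ zero    h []      = h
    ∀*⁻ (suc n) h (x ∷ a) = ∀*⁻ n h a x

    ∃*⁺ : ∀ m {n} {φ : Formula L (m + n)} {b} c → M ⊨ φ [ c ++ b ] → M ⊨ ∃* m φ [ b ]
    ∃*⁺ zero    []      h = h
    ∃*⁺ (suc m) (x ∷ c) h = ∃*⁺ m c (x , h)

    ∃*⁻ : ∀ m {n} {φ : Formula L (m + n)} {b} → M ⊨ ∃* m φ [ b ] → ∃ λ c → M ⊨ φ [ c ++ b ]
    ∃*⁻ zero    h = [] , h
    ∃*⁻ (suc m) h = let c , x , h′ = ∃*⁻ m h in x ∷ c , h′

  ∃*-positive : ∀ m {n} {φ : Formula L (m + n)} → Positive φ → Positive (∃* m φ)
  ∃*-positive zero    φ⁺ = φ⁺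
  ∃*-positive (suc m) φ⁺ = ∃*-positive m (∃′ φ⁺)

  hom-positive : ∀ {A B : Structure L} (f : Hom A B) {n} {φ : Formula L n} → Positive φ →
                 ∀ a → A ⊨ φ [ a ] → B ⊨ φ [ map (fun f) a ]
  hom-positive f (atomic φ⁺) a h        = preserves f φ⁺ a h
  hom-positive f (φ⁺ ∧ ψ⁺)   a (h , h′) = hom-positive f φ⁺ a h , hom-positive f ψ⁺ a h′
  hom-positive f (φ⁺ ∨ ψ⁺)   a h        = Sum.map (hom-positive f φ⁺ a) (hom-positive f ψ⁺ a) h
  hom-positive f (∃′ φ⁺)     a (x , h)  = fun f x , hom-positive f φ⁺ (x ∷ a) h

  _∘ₕ_ : ∀ {A B C : Structure L} → Hom B C → Hom A B → Hom A C
  fun       (g ∘ₕ f) = fun g ∘ fun f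
  preserves (_∘ₕ_ {C = C} g f) {φ = φ} φ⁺ a h =
    subst (λ b → C ⊨ φ [ b ]) (sym (map-∘ (fun g) (fun f) a)) (preserves g φ⁺ _ (preserves f φ⁺ a h))

  Immersion : (M N : Structure L) → (Carrier M → Carrier N) → Set ℓ
  Immersion M N ι = ∀ {n} {φ : Formula L n} → Positive φ → ∀ a →
    (M ⊨ φ [ a ]) ⇔ (N ⊨ φ [ map ι a ])

  -- The premise of an h-inductive implication is positive and passes up to `N`; the conclusion
  -- found there is positive and is reflected back to `M`.
  immersion-hInductive : ∀ {M N : Structure L} {ι} → Immersion M N ι →
                         ∀ {σ} → HInductive σ → N ⊨ σ [ [] ] → M ⊨ σ [ [] ]
  immersion-hInductive {M} {N} im (implication n m k φ⁺ _ ψ⁺ _) h =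
    ∀*⁺ M n λ a h′ → from (im (∃*-positive k ψ⁺) a)
      (∀*⁻ N n h _ (to (im (∃*-positive m φ⁺) a) h′))
  immersion-hInductive im (σ⁺ ∧ τ⁺) (h , h′) =
    immersion-hInductive im σ⁺ h , immersion-hInductive im τ⁺ h′

  immersion-reflects : ∀ {T : Theory L} → HInductiveTheory T →
                       ∀ {M N : Structure L} {ι} → Immersion M N ι → N ⊨ T → M ⊨ T
  immersion-reflects (H , H⁺ , T⇔H) {M} {N} im N⊨T =
    from (T⇔H M) λ σ∈H → immersion-hInductive im (H⁺ σ∈H) (to (T⇔H N) N⊨T σ∈H)

  module _ (N : Structure L) {X : Set ℓ} (ι : X → Carrier N) (x₀ : X)
           (F : ∀ {k} → Language.Func L k → Vec X k → X) where
    open Structure N using (_≈_; domain; ⟦_⟧ᶠ; ⟦_⟧ʳ; func-cong; rel-resp)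
    private module ≈ = Setoid domain

    map⁺ : ∀ {k} {xs ys : Vec X k} → Pointwise (λ x y → ι x ≈ ι y) xs ys →
           Pointwise _≈_ (map ι xs) (map ι ys)
    map⁺ = Pointwise.map⁺ id

    module _ (ι-F : ∀ {k} (f : Language.Func L k) xs → ι (F f xs) ≈ ⟦ f ⟧ᶠ (map ι xs)) where

      -- Equality is pulled back along `ι`, so several elements of `X` may name the same element of
      -- `N`.
      induced : Structure L
      induced = record
        { domain    = On.setoid domain ι
        ; nonempty  = x₀
        ; ⟦_⟧ᶠ      = F
        ; ⟦_⟧ʳ      = λ R xs → ⟦ R ⟧ʳ (map ι xs)
        ; func-cong = λ f e → ≈.trans (ι-F f _) (≈.trans (func-cong f (map⁺ e)) (≈.sym (ι-F f _)))
        ; rel-resp  = λ R e → rel-resp R (map⁺ e)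
        }

      mutual
        ι-eval : ∀ {n} (t : Term L n) a → ι (eval induced t a) ≈ eval N t (map ι a)
        ι-eval (var i)    a = ≈.reflexive (sym (lookup-map i ι a))
        ι-eval (app f ts) a = ≈.trans (ι-F f _) (func-cong f (ι-evals ts a))

        ι-evals : ∀ {n k} (ts : Vec (Term L n) k) a →
                  Pointwise _≈_ (map ι (evals induced ts a)) (evals N ts (map ι a))
        ι-evals []       a = []
        ι-evals (t ∷ ts) a = ι-eval t a ∷ ι-evals ts a

      -- The Tarski–Vaught test.
      induced-immersion :
        (∀ {n} {φ : Formula L (suc n)} → Positive φ → ∀ a →
           N ⊨ ∃′ φ [ map ι a ] → ∃ λ x → N ⊨ φ [ ι x ∷ map ι a ]) →
        Immersion induced N ι
      induced-immersion tv = λ φ⁺ a → mk⇔ (up φ⁺ a) (down φ⁺ a)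
        where
        up : ∀ {n} {φ : Formula L n} → Positive φ → ∀ a →
            induced ⊨ φ [ a ] → N ⊨ φ [ map ι a ]
        up (atomic (s == t))   a h        = ≈.trans (≈.sym (ι-eval s a)) (≈.trans h (ι-eval t a))
        up (atomic (rel R ts)) a h        = rel-resp R (ι-evals ts a) h
        up (φ⁺ ∧ ψ⁺)           a (h , h′) = up φ⁺ a h , up ψ⁺ a h′
        up (φ⁺ ∨ ψ⁺)           a h        = Sum.map (up φ⁺ a) (up ψ⁺ a) h
        up (∃′ φ⁺)             a (x , h)  = ι x , up φ⁺ (x ∷ a) h

        down : ∀ {n} {φ : Formula L n} → Positive φ → ∀ a →
            N ⊨ φ [ map ι a ] → induced ⊨ φ [ a ]
        down (atomic (s == t))   a h        = ≈.trans (ι-eval s a) (≈.trans h (≈.sym (ι-eval t a)))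
        down (atomic (rel R ts)) a h        = rel-resp R (Pointwise.sym ≈.sym (ι-evals ts a)) h
        down (φ⁺ ∧ ψ⁺)           a (h , h′) = down φ⁺ a h , down ψ⁺ a h′
        down (φ⁺ ∨ ψ⁺)           a h        = Sum.map (down φ⁺ a) (down ψ⁺ a) h
        down (∃′ φ⁺)             a h        = let x , h′ = tv φ⁺ a h in x , down φ⁺ (x ∷ a) h′

  -- Renaming of variables.

  mutual
    renameₜ : ∀ {m n} → (Fin m → Fin n) → Term L m → Term L n
    renameₜ ρ (var i)    = var (ρ i)
    renameₜ ρ (app f ts) = app f (renameₜₛ ρ ts)

    renameₜₛ : ∀ {m n k} → (Fin m → Fin n) → Vec (Term L m) k → Vec (Term L n) k
    renameₜₛ ρ []       = []
    renameₜₛ ρ (t ∷ ts) = renameₜ ρ t ∷ renameₜₛ ρ ts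

  under : ∀ {m n} → (Fin m → Fin n) → Fin (suc m) → Fin (suc n)
  under ρ zero    = zero
  under ρ (suc i) = suc (ρ i)

  rename : ∀ {m n} → (Fin m → Fin n) → Formula L m → Formula L n
  rename ρ (s == t)   = renameₜ ρ s == renameₜ ρ t
  rename ρ (rel R ts) = rel R (renameₜₛ ρ ts)
  rename ρ ⊥′         = ⊥′
  rename ρ (φ ∧ ψ)    = rename ρ φ ∧ rename ρ ψ
  rename ρ (φ ∨ ψ)    = rename ρ φ ∨ rename ρ ψ
  rename ρ (φ ⇒ ψ)    = rename ρ φ ⇒ rename ρ ψ
  rename ρ (∀′ φ)     = ∀′ (rename (under ρ) φ)
  rename ρ (∃′ φ)     = ∃′ (rename (under ρ) φ)

  rename-positive : ∀ {m n} {φ : Formula L m} → Positive φ → (ρ : Fin m → Fin n) →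
                    Positive (rename ρ φ)
  rename-positive (atomic (s == t))   ρ = atomic (_ == _)
  rename-positive (atomic (rel R ts)) ρ = atomic (rel R _)
  rename-positive (atomic ⊥′)         ρ = atomic ⊥′
  rename-positive (φ⁺ ∧ ψ⁺)           ρ = rename-positive φ⁺ ρ ∧ rename-positive ψ⁺ ρ
  rename-positive (φ⁺ ∨ ψ⁺)           ρ = rename-positive φ⁺ ρ ∨ rename-positive ψ⁺ ρ
  rename-positive (∃′ φ⁺)             ρ = ∃′ (rename-positive φ⁺ (under ρ))

  module _ (M : Structure L) where

    mutual
      renameₜ-eval : ∀ {m n} (ρ : Fin m → Fin n) (t : Term L m) {a b} →
                     (∀ i → lookup b (ρ i) ≡ lookup a i) → eval M (renameₜ ρ t) b ≡ eval M t a
      renameₜ-eval ρ (var i)    ab = ab i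
      renameₜ-eval ρ (app f ts) ab = cong (Structure.⟦_⟧ᶠ M f) (renameₜₛ-evals ρ ts ab)

      renameₜₛ-evals : ∀ {m n k} (ρ : Fin m → Fin n) (ts : Vec (Term L m) k) {a b} →
                       (∀ i → lookup b (ρ i) ≡ lookup a i) →
                       evals M (renameₜₛ ρ ts) b ≡ evals M ts a
      renameₜₛ-evals ρ []       ab = refl
      renameₜₛ-evals ρ (t ∷ ts) ab = cong₂ _∷_ (renameₜ-eval ρ t ab) (renameₜₛ-evals ρ ts ab)

    under-lookup : ∀ {m n} (ρ : Fin m → Fin n) {a : Vec (Carrier M) m} {b} x →
                   (∀ i → lookup b (ρ i) ≡ lookup a i) →
                   ∀ i → lookup (x ∷ b) (under ρ i) ≡ lookup (x ∷ a) i
    under-lookup ρ x ab zero    = refl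
    under-lookup ρ x ab (suc i) = ab i

    rename-⇔ : ∀ {m n} (ρ : Fin m → Fin n) (φ : Formula L m) {a b} →
               (∀ i → lookup b (ρ i) ≡ lookup a i) → (M ⊨ rename ρ φ [ b ]) ⇔ (M ⊨ φ [ a ])
    rename-⇔ ρ (s == t)   ab = mk⇔ (subst₂ M._≈_ s≡ t≡) (subst₂ M._≈_ (sym s≡) (sym t≡))
      where
      module M = Structure M
      s≡ = renameₜ-eval ρ s ab
      t≡ = renameₜ-eval ρ t ab
    rename-⇔ ρ (rel R ts) ab = mk⇔ (subst M.⟦ R ⟧ʳ ts≡) (subst M.⟦ R ⟧ʳ (sym ts≡))
      where
      module M = Structure M
      ts≡ = renameₜₛ-evals ρ ts ab
    rename-⇔ ρ ⊥′         ab = mk⇔ id id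
    rename-⇔ ρ (φ ∧ ψ)    ab = let φ⇔ = rename-⇔ ρ φ ab ; ψ⇔ = rename-⇔ ρ ψ ab in
      mk⇔ (λ (h , h′) → to φ⇔ h , to ψ⇔ h′) (λ (h , h′) → from φ⇔ h , from ψ⇔ h′)
    rename-⇔ ρ (φ ∨ ψ)    ab = let φ⇔ = rename-⇔ ρ φ ab ; ψ⇔ = rename-⇔ ρ ψ ab in
      mk⇔ (Sum.map (to φ⇔) (to ψ⇔)) (Sum.map (from φ⇔) (from ψ⇔))
    rename-⇔ ρ (φ ⇒ ψ)    ab = let φ⇔ = rename-⇔ ρ φ ab ; ψ⇔ = rename-⇔ ρ ψ ab in
      mk⇔ (λ h → to ψ⇔ ∘ h ∘ from φ⇔) (λ h → from ψ⇔ ∘ h ∘ to φ⇔)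
    rename-⇔ ρ (∀′ φ)     ab = let φ⇔ = λ x → rename-⇔ (under ρ) φ (under-lookup ρ x ab) in
      mk⇔ (λ h x → to (φ⇔ x) (h x)) (λ h x → from (φ⇔ x) (h x))
    rename-⇔ ρ (∃′ φ)     ab = let φ⇔ = λ x → rename-⇔ (under ρ) φ (under-lookup ρ x ab) in
      mk⇔ (λ (x , h) → x , to (φ⇔ x) h) (λ (x , h) → x , from (φ⇔ x) h)

module _ (classical : Classical) where
  open Classical classical renaming (excludedMiddle to em)

  ¬¬-elim : ∀ {a} {P : Set a} → ¬ ¬ P → P
  ¬¬-elim {P = P} ¬¬p with em {P = P}
  ... | yes p = p
  ... | no ¬p = ⊥-elim (¬¬p ¬p)

  -- Excluded middle makes propositions impredicative.
  Resize : ∀ {a} ℓ → Set a → Set ℓ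
  Resize ℓ P = Lift ℓ (True (em {P = P}))

  resize : ∀ {a ℓ} {P : Set a} → P → Resize ℓ P
  resize p = lift (fromWitness p)

  unsize : ∀ {a ℓ} {P : Set a} → Resize ℓ P → P
  unsize = toWitness ∘ lower

  -- Filters and ultrafilters.

  module _ {ℓ} (I : Set ℓ) where

    record Filter : Set (lsuc ℓ) where
      field
        sets   : Pred (Pred I ℓ) ℓ
        univ   : ∀ {X} → (∀ i → i ∈ X) → X ∈ sets
        up     : ∀ {X Y} → X ⊆ Y → X ∈ sets → Y ∈ sets
        inter  : ∀ {X Y} → X ∈ sets → Y ∈ sets → X ∩ Y ∈ sets
        proper : ∀ {X} → Empty X → X ∉ sets

    open Filter

    IsUltra : Pred Filter (lsuc ℓ)
    IsUltra U = ∀ X → X ∈ sets U ⊎ ∁ X ∈ sets U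

    -- The filter generated by `F` and `X`: `Y` belongs to it when the implication from `X` to `Y`
    -- is in `F`, which for empty `Y` would put `∁ X` in `F`.
    adjoin : (F : Filter) (X : Pred I ℓ) → ∁ X ∉ sets F → Filter
    adjoin F X ∁X∉F = record
      { sets   = λ Y → (λ i → i ∈ X → i ∈ Y) ∈ sets F
      ; univ   = λ h → univ F λ i _ → h i
      ; up     = λ Y⊆Z → up F λ h x → Y⊆Z (h x)
      ; inter  = λ h h′ → up F (λ (k , k′) x → k x , k′ x) (inter F h h′)
      ; proper = λ ∅ h → ∁X∉F (up F (λ {i} k x → ∅ i (k x)) h)
      }

    -- A maximal filter above `F` is ultra: unless it contains `∁ X`, adjoining `X` gives a finer
    -- proper filter, which maximality identifies with it.
    ultrafilter : (F : Filter) → Σ Filter λ U → sets F ⊆ sets U × IsUltra U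
    ultrafilter F = U , F⊆U , ultra
      where
      Finer : Set _
      Finer = Σ Filter λ G → sets F ⊆ sets G

      order : Poset _ _ _
      order = On.poset (⊆-poset (Pred I ℓ) ℓ) (sets ∘ proj₁ {B = λ G → sets F ⊆ sets G})

      bound : (C : Pred Finer ℓ) → IsChain order C → ∃ (UpperBound order C)
      bound C chain with em {P = ∃ C}
      ... | no ∄ = (F , id) , λ {x} x∈C → ⊥-elim (∄ (x , x∈C))
      ... | yes (x₀ , x₀∈C) = (G , λ h → resize (x₀ , x₀∈C , proj₂ x₀ h))
                            , λ {x} x∈C h → resize (x , x∈C , h)
        where
        ⋃C : Pred (Pred I ℓ) _
        ⋃C X = ∃ λ x → x ∈ C × X ∈ sets (proj₁ x)

        ⋃-inter : ∀ {X Y} → ⋃C X → ⋃C Y → ⋃C (X ∩ Y)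
        ⋃-inter (x , x∈C , h) (y , y∈C , h′) with chain x∈C y∈C
        ... | inj₁ x≤y = y , y∈C , inter (proj₁ y) (x≤y h) h′
        ... | inj₂ y≤x = x , x∈C , inter (proj₁ x) h (y≤x h′)

        -- `⋃C` quantifies over filters and so lives one level too high; `Resize` brings it down.
        G : Filter
        G = record
          { sets   = Resize ℓ ∘ ⋃C
          ; univ   = λ h → resize (x₀ , x₀∈C , univ (proj₁ x₀) h)
          ; up     = λ X⊆Y h → let x , x∈C , h′ = unsize h in
                       resize (x , x∈C , up (proj₁ x) X⊆Y h′)
          ; inter  = λ h h′ → resize (⋃-inter (unsize h) (unsize h′))
          ; proper = λ ∅ h → let x , _ , h′ = unsize h in proper (proj₁ x) ∅ h′
          }

      maximal : ∃ (MaximalElement order)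
      maximal = zorn order bound

      U : Filter
      U = proj₁ (proj₁ maximal)

      F⊆U : sets F ⊆ sets U
      F⊆U = proj₂ (proj₁ maximal)

      ultra : IsUltra U
      ultra X with em {P = ∁ X ∈ sets U}
      ... | yes ∁X∈U = inj₂ ∁X∈U
      ... | no ∁X∉U = inj₁ (proj₁ (proj₂ maximal {adjoin U X ∁X∉U , U⊆ ∘ F⊆U} U⊆) (univ U λ _ → id))
        where
        U⊆ : sets U ⊆ sets (adjoin U X ∁X∉U)
        U⊆ = up U λ y _ → y

    -- Ultraproducts and Łoś's theorem.

    module Ultraproduct {L : Language ℓ} (U : Filter) (ultra : IsUltra U)
                        (N : I → Structure L) where

      private module N i = Structure (N i)

      at : ∀ i {k} → Vec (∀ j → Carrier (N j)) k → Vec (Carrier (N i)) k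
      at i = map λ x → x i

      at-≈ : ∀ {k} {xs ys : Vec (∀ j → Carrier (N j)) k} →
             Pointwise (λ x y → (λ i → N._≈_ i (x i) (y i)) ∈ sets U) xs ys →
             (λ i → Pointwise (N._≈_ i) (at i xs) (at i ys)) ∈ sets U
      at-≈ []       = univ U λ _ → []
      at-≈ (e ∷ es) = up U (λ (h , h′) → h ∷ h′) (inter U e (at-≈ es))

      ultraproduct : Structure L
      ultraproduct = record
        { domain    = record
          { Carrier       = ∀ i → Carrier (N i)
          ; _≈_           = λ x y → (λ i → N._≈_ i (x i) (y i)) ∈ sets U
          ; isEquivalence = record
            { refl  = univ U λ i → Setoid.refl (N.domain i)
            ; sym   = up U λ {i} → Setoid.sym (N.domain i)
            ; trans = λ h h′ → up U (λ {i} (k , k′) → Setoid.trans (N.domain i) k k′) (inter U h h′)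
            }
          }
        ; nonempty  = λ i → nonempty (N i)
        ; ⟦_⟧ᶠ      = λ f xs i → N.⟦_⟧ᶠ i f (at i xs)
        ; ⟦_⟧ʳ      = λ R xs → (λ i → N.⟦_⟧ʳ i R (at i xs)) ∈ sets U
        ; func-cong = λ f es → up U (λ {i} → N.func-cong i f) (at-≈ es)
        ; rel-resp  = λ R es h → up U (λ {i} (e , k) → N.rel-resp i R e k) (inter U (at-≈ es) h)
        }

      mutual
        eval-at : ∀ {n} (t : Term L n) a i → eval ultraproduct t a i ≡ eval (N i) t (at i a)
        eval-at (var j)    a i = sym (lookup-map j _ a)
        eval-at (app f ts) a i = cong (N.⟦_⟧ᶠ i f) (evals-at ts a i)

        evals-at : ∀ {n k} (ts : Vec (Term L n) k) a i →
                   at i (evals ultraproduct ts a) ≡ evals (N i) ts (at i a)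
        evals-at []       a i = refl
        evals-at (t ∷ ts) a i = cong₂ _∷_ (eval-at t a i) (evals-at ts a i)

      Often : ∀ {n} → Formula L n → Vec (Carrier ultraproduct) n → Set ℓ
      Often φ a = (λ i → N i ⊨ φ [ at i a ]) ∈ sets U

      mutual
        -- The two directions are mutual because implication is contravariant. Ultraness enters at
        -- `⇒` and `∀′` here and at `∨` in `łoś⁻`.
        łoś⁺ : ∀ {n} (φ : Formula L n) a → ultraproduct ⊨ φ [ a ] → Often φ a
        łoś⁺ (s == t)   a h = up U (λ {i} → subst₂ (N._≈_ i) (eval-at s a i) (eval-at t a i)) h
        łoś⁺ (rel R ts) a h = up U (λ {i} → subst (N.⟦_⟧ʳ i R) (evals-at ts a i)) h
        łoś⁺ (φ ∧ ψ)    a (h , h′) = inter U (łoś⁺ φ a h) (łoś⁺ ψ a h′)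
        łoś⁺ (φ ∨ ψ)    a (inj₁ h) = up U inj₁ (łoś⁺ φ a h)
        łoś⁺ (φ ∨ ψ)    a (inj₂ h) = up U inj₂ (łoś⁺ ψ a h)
        łoś⁺ (φ ⇒ ψ)    a h with ultra (λ i → N i ⊨ φ [ at i a ])
        ... | inj₁ k = up U const (łoś⁺ ψ a (h (łoś⁻ φ a k)))
        ... | inj₂ k = up U (λ ¬φ hφ → ⊥-elim (¬φ hφ)) k
        -- If `∀′ φ` failed at almost every index, the pointwise counterexamples would form an
        -- element of the ultraproduct refuting `h`.
        łoś⁺ (∀′ φ)     a h with ultra (λ i → N i ⊨ ∀′ φ [ at i a ])
        ... | inj₁ k = k
        ... | inj₂ k = ⊥-elim (proper U (λ i (¬∀ , hx) → ¬∀ λ y → ¬¬-elim λ ¬φ →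
                                           counterexample-¬ i y ¬φ hx)
                                        (inter U k (łoś⁺ φ (counterexample ∷ a) (h counterexample))))
          where
          counterexample : ∀ i → Carrier (N i)
          counterexample i with em {P = ∃ λ x → ¬ (N i ⊨ φ [ x ∷ at i a ])}
          ... | yes (x , _) = x
          ... | no _        = nonempty (N i)

          counterexample-¬ : ∀ i y → ¬ (N i ⊨ φ [ y ∷ at i a ]) →
                             ¬ (N i ⊨ φ [ counterexample i ∷ at i a ])
          counterexample-¬ i y ¬φ with em {P = ∃ λ x → ¬ (N i ⊨ φ [ x ∷ at i a ])}
          ... | yes (_ , h) = h
          ... | no ∄        = ⊥-elim (∄ (y , ¬φ))
        łoś⁺ (∃′ φ)     a (x , h) = up U (λ {i} k → x i , k) (łoś⁺ φ (x ∷ a) h)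

        łoś⁻ : ∀ {n} (φ : Formula L n) a → Often φ a → ultraproduct ⊨ φ [ a ]
        łoś⁻ (s == t)   a h =
          up U (λ {i} → subst₂ (N._≈_ i) (sym (eval-at s a i)) (sym (eval-at t a i))) h
        łoś⁻ (rel R ts) a h = up U (λ {i} → subst (N.⟦_⟧ʳ i R) (sym (evals-at ts a i))) h
        łoś⁻ ⊥′         a h = ⊥-elim (proper U (λ _ ()) h)
        łoś⁻ (φ ∧ ψ)    a h = łoś⁻ φ a (up U proj₁ h) , łoś⁻ ψ a (up U proj₂ h)
        łoś⁻ (φ ∨ ψ)    a h with ultra (λ i → N i ⊨ φ [ at i a ])
        ... | inj₁ k = inj₁ (łoś⁻ φ a k)
        ... | inj₂ k = inj₂ (łoś⁻ ψ a (up U (λ (¬φ , φ∨ψ) → [ ⊥-elim ∘ ¬φ , id ] φ∨ψ) (inter U k h)))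
        łoś⁻ (φ ⇒ ψ)    a h k =
          łoś⁻ ψ a (up U (λ (φ⇒ψ , hφ) → φ⇒ψ hφ) (inter U h (łoś⁺ φ a k)))
        łoś⁻ (∀′ φ)     a h x = łoś⁻ φ (x ∷ a) (up U (λ {i} k → k (x i)) h)
        łoś⁻ (∃′ φ)     a h = witness , łoś⁻ φ (witness ∷ a) (up U (λ {i} → witness-⊨ i) h)
          where
          witness : ∀ i → Carrier (N i)
          witness i with em {P = N i ⊨ ∃′ φ [ at i a ]}
          ... | yes (x , _) = x
          ... | no _        = nonempty (N i)

          witness-⊨ : ∀ i → N i ⊨ ∃′ φ [ at i a ] → N i ⊨ φ [ witness i ∷ at i a ]
          witness-⊨ i h′ with em {P = N i ⊨ ∃′ φ [ at i a ]}
          ... | yes (_ , k) = k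
          ... | no ∄        = ⊥-elim (∄ h′)

  -- Compactness.

  module _ {ℓ} {L : Language ℓ} where

    -- A formula with the elements of W as its free variables.
    Instance : Set ℓ → Set ℓ
    Instance W = Σ ℕ λ n → Formula L n × Vec W n

    Holds : ∀ {W} (N : Structure L) → (W → Carrier N) → Pred (Instance W) ℓ
    Holds N e (_ , φ , d) = N ⊨ φ [ map e d ]

    Realized : ∀ {W ℓ′} → Theory L → Pred (Instance W) ℓ′ → Set _
    Realized {W} T Γ = Σ (Structure L) λ N → N ⊨ T × Σ (W → Carrier N) λ e → Γ ⊆ Holds N e

    abstract
      -- The factor at a finite list realizes those of its members that lie in `Γ`. For `x` in `Γ`
      -- the lists containing `x` form a set of `tails`, so by Łoś's theorem the ultraproduct
      -- satisfies `x`.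
      compactness : ∀ {W ℓ′} (T : Theory L) (Γ : Pred (Instance W) ℓ′) →
                    (∀ {xs} → ListAll.All Γ xs → Realized T (List._∈ xs)) → Realized T Γ
      compactness {W} T Γ finite = ultraproduct
                                 , (λ {σ} σ∈T → łoś⁻ σ []
                                     (univ λ i → proj₁ (proj₂ (model i)) σ∈T))
                                 , e
                                 , λ {x} → Γ-holds x
        where
        -- All lists, not only those from `Γ`: this keeps the index set at level `ℓ`, whatever the
        -- level of `Γ`.
        I : Set ℓ
        I = List (Instance W)

        dec : ∀ x → Dec (Γ x)
        dec x = em

        model : ∀ i → Realized T (List._∈ filter dec i)
        model i = finite (ListAll.tabulate (proj₂ ∘ ∈-filter⁻ dec {xs = i}))

        N : I → Structure L
        N i = proj₁ (model i)

        tails : Filter I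
        tails = record
          { sets   = λ X → ∃ λ j → ∀ i → (∀ {x} → x List.∈ j → x List.∈ i) → i ∈ X
          ; univ   = λ h → [] , λ i _ → h i
          ; up     = λ X⊆Y (j , h) → j , λ i j⊆i → X⊆Y (h i j⊆i)
          ; inter  = λ (j , h) (k , h′) → j ++ₗ k , λ i jk⊆i →
                       h i (jk⊆i ∘ ∈-++⁺ˡ) , h′ i (jk⊆i ∘ ∈-++⁺ʳ j)
          ; proper = λ ∅ (j , h) → ∅ j (h j id)
          }

        U : Σ (Filter I) λ U → Filter.sets tails ⊆ Filter.sets U × IsUltra I U
        U = ultrafilter I tails

        open Filter (proj₁ U)
        open Ultraproduct I (proj₁ U) (proj₂ (proj₂ U)) N

        e : W → Carrier ultraproduct
        e w i = proj₁ (proj₂ (proj₂ (model i))) w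

        Γ-holds : ∀ x → Γ x → Holds ultraproduct e x
        Γ-holds x@(_ , φ , d) x∈Γ = łoś⁻ φ (map e d) (proj₁ (proj₂ U) (x ∷ [] , λ i x∈i →
          subst (λ b → N i ⊨ φ [ b ]) (map-∘ _ e d)
            (proj₂ (proj₂ (proj₂ (model i))) (∈-filter⁺ dec (x∈i (here refl)) x∈Γ))))

  -- Extending a model to an h-maximal one.

  module HMaximalExtension {ℓ} {L : Language ℓ} {T : Theory L} (hT : HInductiveTheory T)
                           (A : Structure L) (A⊨T : A ⊨ T) where

    -- Henkin constants over A.  In a stage the constants of D are in use, and only
    -- these matter.  A maximal stage decides all positive formulas on D, and hence
    -- has all witnesses there, so that D names an immersed h-maximal model.
    data W : Set ℓ where
      base : Carrier A → W
      wit  : ∀ {n} → Formula L (suc n) → Vec W n → W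

    record Stage : Set (lsuc ℓ) where
      field
        N    : Structure L
        N⊨T  : N ⊨ T
        name : W → Carrier N
        D    : Pred W ℓ

      diagram : Pred (Instance W) ℓ
      diagram (_ , φ , d) = Positive φ × All D d × N ⊨ φ [ map name d ]

      field
        base-diagram : ∀ {n} {φ : Formula L n} → Atomic φ → ∀ a → A ⊨ φ [ a ] →
                       (n , φ , map base a) ∈ diagram
        wit-diagram  : ∀ {n} (φ : Formula L (suc n)) d → D (wit φ d) →
                       (suc n , φ , wit φ d ∷ d) ∈ diagram

    open Stage

    -- Only diagrams are compared, never models: a bound may take its model from compactness, and
    -- the model of a maximal stage may be exchanged for any other model of `T` in which its diagram
    -- holds.
    order : Poset _ _ _
    order = On.poset (⊆-poset (Instance W) ℓ) diagram

    -- Read off from the equation of `a` with itself: a diagram mentions only constants in use.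
    base∈D : ∀ x a → D x (base a)
    base∈D x a = All.head (proj₁ (proj₂ (base-diagram x {φ = var zero == var zero} (_ == _) (a ∷ [])
                   (Setoid.refl (Structure.domain A)))))

    initial : Stage
    initial = record
      { N            = A
      ; N⊨T          = A⊨T
      ; name         = name₀
      ; D            = D₀
      ; base-diagram = λ {n} {φ} φ⁺ a h → atomic φ⁺ , all-base a ,
                         subst (λ b → A ⊨ φ [ b ]) (sym (trans (sym (map-∘ name₀ base a)) (map-id a))) h
      ; wit-diagram  = λ _ _ ()
      }
      where
      name₀ : W → Carrier A
      name₀ (base a)  = a
      name₀ (wit _ _) = nonempty A

      D₀ : Pred W ℓ
      D₀ (base _)  = ⊤
      D₀ (wit _ _) = Polymorphic.⊥

      all-base : ∀ {n} (a : Vec (Carrier A) n) → All D₀ (map base a)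
      all-base []      = []
      all-base (_ ∷ a) = _ ∷ all-base a

    -- Finitely many instances from the diagrams of a chain all lie in one of them, so compactness
    -- gives a single model of all. The diagram read off in that model may exceed the union, which
    -- does no harm to a bound.
    bound : (C : Pred Stage ℓ) → IsChain order C → ∃ (UpperBound order C)
    bound C chain with em {P = ∃ C}
    ... | no ∄ = initial , λ {x} x∈C → ⊥-elim (∄ (x , x∈C))
    ... | yes (x₀ , x₀∈C) = union , λ {x} → ≤-union {x}
      where
      ⋃C : Pred (Instance W) _
      ⋃C δ = ∃ λ x → x ∈ C × δ ∈ diagram x

      finite : ∀ {xs} → ListAll.All ⋃C xs → ∃ λ x → x ∈ C × ListAll.All (diagram x) xs
      finite [] = x₀ , x₀∈C , []
      finite ((x , x∈C , δ) ∷ δs) with finite δs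
      ... | y , y∈C , δs′ with chain x∈C y∈C
      ...   | inj₁ x≤y = y , y∈C , x≤y δ ∷ δs′
      ...   | inj₂ y≤x = x , x∈C , δ ∷ ListAll.map y≤x δs′

      model : Realized T ⋃C
      model = compactness T ⋃C λ δs → let x , _ , δs′ = finite δs in
        N x , N⊨T x , name x , λ δ∈ → proj₂ (proj₂ (ListAll.lookup δs′ δ∈))

      D∪ : Pred W ℓ
      D∪ w = Resize ℓ (∃ λ x → x ∈ C × D x w)

      lift-diagram : ∀ {x} → x ∈ C → ∀ {δ} → δ ∈ diagram x →
        Positive (proj₁ (proj₂ δ)) × All D∪ (proj₂ (proj₂ δ)) ×
        Holds (proj₁ model) (proj₁ (proj₂ (proj₂ model))) δ
      lift-diagram {x} x∈C δ∈@(φ⁺ , d∈D , _) =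
        φ⁺ , All.map (λ w∈D → resize (x , x∈C , w∈D)) d∈D
           , proj₂ (proj₂ (proj₂ model)) (x , x∈C , δ∈)

      union : Stage
      union = record
        { N            = proj₁ model
        ; N⊨T          = proj₁ (proj₂ model)
        ; name         = proj₁ (proj₂ (proj₂ model))
        ; D            = D∪
        ; base-diagram = λ φ⁺ a h → lift-diagram x₀∈C (base-diagram x₀ φ⁺ a h)
        ; wit-diagram  = λ φ d w∈D → let x , x∈C , w∈Dx = unsize w∈D in
                           lift-diagram x∈C (wit-diagram x φ d w∈Dx)
        }

      ≤-union : ∀ {x} → x ∈ C → diagram x ⊆ diagram union
      ≤-union x∈C = lift-diagram x∈C

    abstract
      maximal : ∃ (MaximalElement order)
      maximal = zorn order bound

    top : Stage
    top = proj₁ maximal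

    open Stage top using () renaming
      (N to B; N⊨T to B⊨T; name to ν; D to E; diagram to Δ; base-diagram to base-Δ; wit-diagram to wit-Δ)

    -- Naming the constants of top in N′ instead gives a stage above it.
    decide : ∀ {n} {φ : Formula L n} → Positive φ → ∀ {d} → All E d →
             ∀ N′ → N′ ⊨ T → (e : W → Carrier N′) → Δ ⊆ Holds N′ e →
             N′ ⊨ φ [ map e d ] → (n , φ , d) ∈ Δ
    decide φ⁺ {d} d∈E N′ N′⊨T e Δ⊆ h = proj₁ (proj₂ maximal {x} lift-Δ) (φ⁺ , d∈E , h)
      where
      lift-Δ : ∀ {δ} → δ ∈ Δ → Positive (proj₁ (proj₂ δ)) × All E (proj₂ (proj₂ δ)) × Holds N′ e δ
      lift-Δ δ∈@(φ⁺ , d∈E , _) = φ⁺ , d∈E , Δ⊆ δ∈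

      x : Stage
      x = record
        { N            = N′
        ; N⊨T          = N′⊨T
        ; name         = e
        ; D            = E
        ; base-diagram = λ φ⁺ a h → lift-Δ (base-Δ φ⁺ a h)
        ; wit-diagram  = λ φ d w∈E → lift-Δ (wit-Δ φ d w∈E)
        }

    -- If `wit φ d` is not yet in use, let it name the witness `b` in `B`. No other name changes, so
    -- the old diagram survives, and maximality puts the new instance in `Δ`.
    witnessed : ∀ {n} {φ : Formula L (suc n)} {d} → (n , ∃′ φ , d) ∈ Δ →
                (suc n , φ , wit φ d ∷ d) ∈ Δ
    witnessed {n} {φ} {d} (∃′ φ⁺ , d∈E , b , h) with em {P = E (wit φ d)}
    ... | yes w∈E = wit-Δ φ d w∈E
    ... | no w∉E = proj₁ (proj₂ maximal {x} lift-Δ) new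
      where
      w = wit φ d

      ν′ : W → Carrier B
      ν′ v with em {P = v ≡ w}
      ... | yes _ = b
      ... | no _  = ν v

      ν′-old : ∀ {v} → E v → ν′ v ≡ ν v
      ν′-old {v} v∈E with em {P = v ≡ w}
      ... | yes refl = ⊥-elim (w∉E v∈E)
      ... | no _     = refl

      ν′-new : ν′ w ≡ b
      ν′-new with em {P = w ≡ w}
      ... | yes _ = refl
      ... | no w≢w = ⊥-elim (w≢w refl)

      ν′-olds : ∀ {k} {c : Vec W k} → All E c → map ν′ c ≡ map ν c
      ν′-olds []          = refl
      ν′-olds (v∈E ∷ vs∈E) = cong₂ _∷_ (ν′-old v∈E) (ν′-olds vs∈E)

      E′ : Pred W ℓ
      E′ v = E v ⊎ v ≡ w

      Δ′ : Pred (Instance W) ℓ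
      Δ′ δ = Positive (proj₁ (proj₂ δ)) × All E′ (proj₂ (proj₂ δ)) × Holds B ν′ δ

      lift-Δ : ∀ {δ} → δ ∈ Δ → δ ∈ Δ′
      lift-Δ {_ , ψ , _} (ψ⁺ , c∈E , k) =
        ψ⁺ , All.map inj₁ c∈E , subst (λ a → B ⊨ ψ [ a ]) (sym (ν′-olds c∈E)) k

      new : (suc n , φ , w ∷ d) ∈ Δ′
      new = φ⁺ , inj₂ refl ∷ All.map inj₁ d∈E
          , subst (λ a → B ⊨ φ [ a ]) (sym (cong₂ _∷_ ν′-new (ν′-olds d∈E))) h

      wit-Δ′ : ∀ {k} (ψ : Formula L (suc k)) c → E′ (wit ψ c) → (suc k , ψ , wit ψ c ∷ c) ∈ Δ′
      wit-Δ′ ψ c (inj₁ v∈E)  = lift-Δ (wit-Δ ψ c v∈E)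
      wit-Δ′ ψ c (inj₂ refl) = new

      x : Stage
      x = record
        { N            = B
        ; N⊨T          = B⊨T
        ; name         = ν′
        ; D            = E′
        ; base-diagram = λ ψ⁺ a k → lift-Δ (base-Δ ψ⁺ a k)
        ; wit-diagram  = wit-Δ′
        }

    X : Set ℓ
    X = Σ W E

    ι : X → Carrier B
    ι = ν ∘ proj₁

    all-E : ∀ {k} (a : Vec X k) → All E (map proj₁ a)
    all-E []            = []
    all-E ((_ , w∈E) ∷ a) = w∈E ∷ all-E a

    map-ι : ∀ {k} (a : Vec X k) → map ι a ≡ map ν (map proj₁ a)
    map-ι = map-∘ ν proj₁

    ⊨⇒Δ : ∀ {n} {φ : Formula L n} → Positive φ → ∀ (a : Vec X n) → B ⊨ φ [ map ι a ] →
          (n , φ , map proj₁ a) ∈ Δ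
    ⊨⇒Δ {φ = φ} φ⁺ a h = φ⁺ , all-E a , subst (λ b → B ⊨ φ [ b ]) (map-ι a) h

    tarski-vaught : ∀ {n} {φ : Formula L (suc n)} → Positive φ → ∀ (a : Vec X n) →
                    B ⊨ ∃′ φ [ map ι a ] → ∃ λ x → B ⊨ φ [ ι x ∷ map ι a ]
    tarski-vaught {φ = φ} φ⁺ a h with witnessed (⊨⇒Δ (∃′ φ⁺) a h)
    ... | _ , w∈E ∷ _ , k = (w , w∈E) , subst (λ b → B ⊨ φ [ ν w ∷ b ]) (sym (map-ι a)) k
      where w = wit φ (map proj₁ a)

    vars : ∀ k → Vec (Term L (suc k)) k
    vars k = tabulate (var ∘ suc)

    evals-tabulate : ∀ {k m} (g : Fin m → Fin (suc k)) (a : Vec (Carrier B) (suc k)) →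
                     evals B (tabulate (var ∘ g)) a ≡ tabulate (lookup a ∘ g)
    evals-tabulate {m = zero}  g a = refl
    evals-tabulate {m = suc m} g a = cong (lookup a (g zero) ∷_) (evals-tabulate (g ∘ suc) a)

    evals-vars : ∀ {k} x (a : Vec (Carrier B) k) → evals B (vars k) (x ∷ a) ≡ a
    evals-vars x a = trans (evals-tabulate suc (x ∷ a)) (tabulate∘lookup a)

    graph : ∀ {k} → Language.Func L k → Formula L (suc k)
    graph {k} f = var zero == app f (vars k)

    -- The operations of the submodel are Henkin witnesses too, so function symbols need no
    -- constants of their own.
    value : ∀ {k} (f : Language.Func L k) (a : Vec X k) → ∃ λ x → B ⊨ graph f [ ι x ∷ map ι a ]
    value f a = tarski-vaught (atomic (var zero == app f (vars _))) a
      (b , Setoid.reflexive domain (cong ⟦ f ⟧ᶠ (sym (evals-vars b (map ι a)))))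
      where
      open Structure B
      b = ⟦ f ⟧ᶠ (map ι a)

    ι-value : ∀ {k} (f : Language.Func L k) (a : Vec X k) →
              Structure._≈_ B (ι (proj₁ (value f a))) (Structure.⟦_⟧ᶠ B f (map ι a))
    ι-value f a = Setoid.trans domain (proj₂ (value f a))
      (Setoid.reflexive domain (cong ⟦ f ⟧ᶠ (evals-vars (ι (proj₁ (value f a))) (map ι a))))
      where open Structure B

    M : Structure L
    M = induced B ι (base (nonempty A) , base∈D top _) (λ f a → proj₁ (value f a)) ι-value

    M→B : Immersion M B ι
    M→B = induced-immersion B ι _ _ ι-value tarski-vaught

    M⊨T : M ⊨ T
    M⊨T = immersion-reflects hT M→B B⊨T

    include : Carrier A → X
    include a = base a , base∈D top a

    map-include : ∀ {n} (a : Vec (Carrier A) n) → map ν (map base a) ≡ map ι (map include a)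
    map-include a = trans (sym (map-∘ ν base a)) (map-∘ ι include a)

    A→M : Hom A M
    A→M = record
      { fun       = include
      ; preserves = λ {_} {φ} φ⁺ a h → from (M→B (atomic φ⁺) (map include a))
          (subst (λ b → B ⊨ φ [ b ]) (map-include a) (proj₂ (proj₂ (base-Δ φ⁺ a h))))
      }

    -- Through `g` the constants of `E` name elements of `N′`, and `Δ` holds of them because `g`
    -- preserves positive formulas. By `decide`, an atomic formula true of them was in `Δ` already,
    -- hence true in `B` and, by immersion, in `M`.
    M-embeds : ∀ N′ → N′ ⊨ T → (g : Hom M N′) → IsEmbedding g
    M-embeds N′ N′⊨T g {n} {φ} φ⁺ a = mk⇔ (preserves g φ⁺ a) λ h →
      from (M→B (atomic φ⁺) a) (subst (λ b → B ⊨ φ [ b ]) (sym (map-ι a))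
        (proj₂ (proj₂ (decide (atomic φ⁺) (all-E a) N′ N′⊨T e Δ⊆
          (⊨-resp N′ φ (Pointwise.sym (Setoid.sym domain) (e-agrees a)) h)))))
      where
      open Structure N′ using (domain; _≈_)

      e : W → Carrier N′
      e w with em {P = E w}
      ... | yes w∈E = fun g (w , w∈E)
      ... | no _    = nonempty N′

      e-agree : ∀ x → e (proj₁ x) ≈ fun g x
      e-agree x@(w , w∈E) with em {P = E w}
      -- `E w` may have several proofs; the elements of `X` they give have the same name, so are
      -- equal in `M`, and `g` preserves that equation.
      ... | yes w∈E′ = preserves g {φ = var zero == var (suc zero)} (_ == _) ((w , w∈E′) ∷ x ∷ [])
                         (Setoid.refl (Structure.domain B))
      ... | no w∉E = ⊥-elim (w∉E w∈E)

      e-agrees : ∀ {k} (c : Vec X k) → Pointwise _≈_ (map e (map proj₁ c)) (map (fun g) c)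
      e-agrees []      = []
      e-agrees (x ∷ c) = e-agree x ∷ e-agrees c

      attach : ∀ {k} {d : Vec W k} → All E d → ∃ λ (c : Vec X k) → map proj₁ c ≡ d
      attach []          = [] , refl
      attach (w∈E ∷ ws∈E) = let c , eq = attach ws∈E in (_ , w∈E) ∷ c , cong (_ ∷_) eq

      Δ⊆ : Δ ⊆ Holds N′ e
      Δ⊆ {_ , ψ , d} (ψ⁺ , d∈E , h) with attach d∈E
      ... | c , refl = ⊨-resp N′ ψ (Pointwise.sym (Setoid.sym domain) (e-agrees c))
        (hom-positive g ψ⁺ c (from (M→B ψ⁺ c) (subst (λ b → B ⊨ ψ [ b ]) (sym (map-ι c)) h)))

  abstract
    hMaximal-extension : ∀ {ℓ} {L : Language ℓ} {T : Theory L} → HInductiveTheory T →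
                         ∀ A → A ⊨ T → Σ (Structure L) λ M → M ∈ HMaximal T × Hom A M
    hMaximal-extension hT A A⊨T = M , (M⊨T , M-embeds) , A→M
      where open HMaximalExtension hT A A⊨T

  -- The additional last entry `x₀` gives `pos` a value off the list and makes `m` positive even
  -- when the list is empty.
  enumerate : ∀ {a} {A : Set a} → A → (xs : List A) →
              ∃ λ m → Σ (Vec A m) λ c → Σ (A → Fin m) λ pos →
                ∀ {x} → x List.∈ xs → lookup c (pos x) ≡ x
  enumerate x₀ [] = 1 , x₀ ∷ [] , const zero , λ ()
  enumerate {A = A} x₀ (x ∷ xs) with enumerate x₀ xs
  ... | m , c , pos , found = suc m , x ∷ c , pos′ , found′
    where
    pos′ : A → Fin (suc m)
    pos′ y with em {P = y ≡ x}
    ... | yes _ = zero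
    ... | no _  = suc (pos y)

    found′ : ∀ {y} → y List.∈ (x ∷ xs) → lookup (x ∷ c) (pos′ y) ≡ y
    found′ {y} y∈ with em {P = y ≡ x} | y∈
    ... | yes refl | _          = refl
    ... | no y≢x   | here y≡x   = ⊥-elim (y≢x y≡x)
    ... | no _     | there y∈xs = found y∈xs

  -- Types and their realizations.

  module _ {ℓ} {L : Language ℓ} {T : Theory L} where
    open S

    _⊩_[_] : ∀ {n} (N : Structure L) → S T n → Vec (Carrier N) n → Set ℓ
    N ⊩ p [ b ] = ∀ {φ} → φ ∈ formulas p → N ⊨ proj₁ φ [ b ]

    -- The positive formulas true of `b` form a consistent set containing `p`, which by maximality
    -- is `p`.
    ⊩-complete : ∀ {n} (p : S T n) {N} → N ⊨ T → ∀ {b} → N ⊩ p [ b ] →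
                 ∀ φ → N ⊨ proj₁ φ [ b ] → φ ∈ formulas p
    ⊩-complete p {N} N⊨T {b} N⊩p φ = maximal p (λ ψ → N ⊨ proj₁ ψ [ b ]) (N , N⊨T , b , id) N⊩p

    ⊥∉ : ∀ {n} (p : S T n) → (⊥′ , atomic ⊥′) ∉ formulas p
    ⊥∉ p ⊥∈p = let _ , _ , _ , N⊩p = consistent p in lower (N⊩p ⊥∈p)

    -- Types are prime: a realization of `p` satisfies no positive formula outside `p`, hence
    -- neither disjunct.
    ∨∉ : ∀ {n} (p : S T n) {φ ψ} → φ ∉ formulas p → ψ ∉ formulas p →
         (proj₁ φ ∨ proj₁ ψ , proj₂ φ ∨ proj₂ ψ) ∉ formulas p
    ∨∉ p {φ} {ψ} φ∉p ψ∉p φ∨ψ∈p = let _ , N⊨T , _ , N⊩p = consistent p in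
      [ φ∉p ∘ ⊩-complete p N⊨T N⊩p φ , ψ∉p ∘ ⊩-complete p N⊨T N⊩p ψ ] (N⊩p φ∨ψ∈p)

    -- Mapping a structure to a realization of a type.

    module _ {n} (M : Structure L) (a : Vec (Carrier M) n) (p : S T n)
             (tp⊆p : ∀ φ → M ⊨ proj₁ φ [ a ] → φ ∈ formulas p) where

      private
        -- The entries of a get variables of their own: a may have repeated entries,
        -- whose counterparts in a realization of p are equal only up to ≈.
        W : Set ℓ
        W = Carrier M ⊎ Fin n

        value : W → Carrier M
        value = [ id , lookup a ]

      data Requirement : Pred (Instance {L = L} W) ℓ where
        diagram : ∀ {k} {φ : Formula L k} {d} → Positive φ → M ⊨ φ [ map value d ] →
                  Requirement (k , φ , d)
        typical : ∀ {φ} → φ ∈ formulas p → Requirement (n , proj₁ φ , tabulate inj₂)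

      module _ (xs : List (Instance {L = L} W)) where
        private
          params : List (Carrier M)
          params = concatMap (λ δ → toList (map value (proj₂ (proj₂ δ)))) xs

          enumeration = enumerate (nonempty M) params
          m     = proj₁ enumeration
          c     = proj₁ (proj₂ enumeration)
          pos   = proj₁ (proj₂ (proj₂ enumeration))

        ρ : W → Fin (m + n)
        ρ = [ (λ x → pos x ↑ˡ n) , m ↑ʳ_ ]

        ρ-value : ∀ w → value w List.∈ params → lookup (c ++ a) (ρ w) ≡ value w
        ρ-value (inj₁ x) x∈ = trans (lookup-++ˡ c a (pos x)) (proj₂ (proj₂ (proj₂ enumeration)) x∈)
        ρ-value (inj₂ i) _  = lookup-++ʳ c a i

        ρ-lookup : ∀ {k φ d} → (k , φ , d) List.∈ xs →
                   ∀ i → lookup (c ++ a) (ρ (lookup d i)) ≡ lookup (map value d) i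
        ρ-lookup {d = d} δ∈xs i = trans
          (ρ-value (lookup d i) (subst (List._∈ params) (lookup-map i value d)
            (∈-concatMap⁺ _ (List.lose δ∈xs (∈-toList⁺ (∈-lookup i (map value d)))))))
          (sym (lookup-map i value d))

        -- The diagram instances merge into one positive formula, whose first `m` variables stand
        -- for parameters from `M` and last `n` for `a`. The `typical` instances stay out of it, as
        -- they hold at every realization of `p`.
        conjunction : ∀ {ys} → (∀ {δ} → δ List.∈ ys → δ List.∈ xs) → ListAll.All Requirement ys →
          Σ (Formula L (m + n)) λ χ → Positive χ × M ⊨ χ [ c ++ a ] ×
            (∀ N y b → N ⊩ p [ b ] → N ⊨ χ [ y ++ b ] →
               ListAll.All (Holds N (lookup (y ++ b) ∘ ρ)) ys)
        conjunction ys⊆xs [] =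
          -- A true formula for the empty conjunction; `m` is positive, so a variable exists even if
          -- `n` is zero.
          t == t , atomic (t == t) , Setoid.refl (Structure.domain M) , λ _ _ _ _ _ → []
          where t = var (pos (nonempty M) ↑ˡ n)
        conjunction ys⊆xs (typical {φ} φ∈p ∷ rs) with conjunction (ys⊆xs ∘ there) rs
        ... | χ , χ⁺ , Mχ , hold = χ , χ⁺ , Mχ , λ N y b N⊩p h →
          subst (λ d → N ⊨ proj₁ φ [ d ])
            (sym (map-tabulate _ inj₂ (lookup-++ʳ y b))) (N⊩p φ∈p) ∷ hold N y b N⊩p h
        conjunction ys⊆xs (diagram {φ = φ} {d} φ⁺ Mφ ∷ rs) with conjunction (ys⊆xs ∘ there) rs
        ... | χ , χ⁺ , Mχ , hold =
          rename (ρ ∘ lookup d) φ ∧ χ , rename-positive φ⁺ _ ∧ χ⁺ ,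
          (from (rename-⇔ M _ φ (ρ-lookup (ys⊆xs (here refl)))) Mφ , Mχ) ,
          λ N y b N⊩p (hφ , hχ) →
            to (rename-⇔ N _ φ λ i → sym (lookup-map i (lookup (y ++ b) ∘ ρ) d)) hφ ∷ hold N y b N⊩p hχ

        -- In `M` the parameters witness `∃* m χ` at `a`, so this positive formula is in `p`, and
        -- any realization of `p` yields values `y` for the parameters.
        finitely-realized : ListAll.All Requirement xs → Realized T (List._∈ xs)
        finitely-realized rs with conjunction id rs | consistent p
        ... | χ , χ⁺ , Mχ , hold | N , N⊨T , b , N⊩p =
          let y , h = ∃*⁻ N m (N⊩p (tp⊆p (∃* m χ , ∃*-positive m χ⁺) (∃*⁺ M m c Mχ)))
          in N , N⊨T , lookup (y ++ b) ∘ ρ , ListAll.lookup (hold N y b N⊩p h)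

      extend-to-type : Σ (Structure L) λ N → N ⊨ T × Σ (Hom M N) λ f → N ⊩ p [ map (fun f) a ]
      extend-to-type with compactness T Requirement (λ {xs} → finitely-realized xs)
      ... | N , N⊨T , e , holds = N , N⊨T , f , λ {φ} φ∈p →
        ⊨-resp N (proj₁ φ) agree (holds (typical {φ} φ∈p))
        where
        open Structure N using (_≈_)

        f : Hom M N
        f = record
          { fun       = e ∘ inj₁
          ; preserves = λ {_} {φ} φ⁺ d h → subst (λ d → N ⊨ φ [ d ]) (sym (map-∘ e inj₁ d))
              (holds (diagram (atomic φ⁺) (subst (λ d → M ⊨ φ [ d ])
                (sym (trans (sym (map-∘ value inj₁ d)) (map-id d))) h)))
          }

        agree : Pointwise _≈_ (map e (tabulate inj₂)) (map (e ∘ inj₁) a)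
        agree = subst₂ (Pointwise _≈_) (tabulate-∘ e inj₂)
          (trans (tabulate-∘ (e ∘ inj₁) (lookup a)) (cong (map (e ∘ inj₁)) (tabulate∘lookup a)))
          -- Both sides have the same `value`, so the diagram contains the equation of each fresh
          -- variable with its entry of `a`.
          (Pointwise.tabulate⁺ λ i →
            holds (diagram {φ = var zero == var (suc zero)} {d = inj₂ i ∷ inj₁ (lookup a i) ∷ []}
              (atomic (_ == _)) (Setoid.refl (Structure.domain M))))

    -- Separation by complements of basic closed sets.

    Separated : ∀ {n} → S T n → S T n → Set _
    Separated {n} p q = Σ (PositiveFormula L n) λ φ → Σ (PositiveFormula L n) λ ψ →
      φ ∉ formulas p × ψ ∉ formulas q × (∀ (r : S T n) → φ ∈ formulas r ⊎ ψ ∈ formulas r)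

    ∁F-open : ∀ {n} (φ : PositiveFormula L n) → Open T (∁ (F T φ))
    ∁F-open φ = F T φ , ((φ ≡_) , (λ { φ∈p refl → φ∈p }) , λ h → h refl) , id , id

    separated⇒disjoint : ∀ {n} (p q : S T n) → Separated p q →
      Σ (Pred (S T n) ℓ) λ U → Σ (Pred (S T n) ℓ) λ V →
        Open T U × Open T V × p ∈ U × q ∈ V × Empty (U ∩ V)
    separated⇒disjoint p q (φ , ψ , φ∉p , ψ∉q , cover) =
      ∁ (F T φ) , ∁ (F T ψ) , ∁F-open φ , ∁F-open ψ , φ∉p , ψ∉q ,
      λ r (φ∉r , ψ∉r) → [ φ∉r , ψ∉r ] (cover r)

    module _ (hT : HInductiveTheory T) where

      -- A common restriction of two inseparable types.

      module _ (elementary : Elementary (HMaximal T)) {n} (p q : S T n) (¬sep : ¬ Separated p q) where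
        private
          Θ = proj₁ elementary

          W : Set ℓ
          W = Lift ℓ (Fin n)

        -- Omission is a negation, which is not positive; hence compactness for all first-order
        -- formulas.
        data Omitted : Pred (Instance {L = L} W) ℓ where
          omitted : ∀ φ → φ ∉ formulas p ⊎ φ ∉ formulas q →
                    Omitted (n , (proj₁ φ ⇒ ⊥′) , tabulate lift)

        refute : ∀ N (χ : PositiveFormula L n) {a} → ¬ (N ⊨ proj₁ χ [ a ]) →
                 Holds N (lookup a ∘ lower) (n , (proj₁ χ ⇒ ⊥′) , tabulate (lift {ℓ = ℓ}))
        refute N χ {a} ¬χ h = ⊥-elim (¬χ (subst (λ b → N ⊨ proj₁ χ [ b ])
          (map-tabulate (lookup a ∘ lower) lift λ _ → refl) h))

        -- Formulas missing from `p` go into the disjunction `φ`, the others, missing from `q`, into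
        -- `ψ`. As types are prime, the disjunctions are still missing.
        disjunctions : ∀ {xs} → ListAll.All Omitted xs →
          Σ (PositiveFormula L n) λ φ → Σ (PositiveFormula L n) λ ψ →
            φ ∉ formulas p × ψ ∉ formulas q ×
            (∀ N a → ¬ (N ⊨ proj₁ φ [ a ]) → ¬ (N ⊨ proj₁ ψ [ a ]) →
               ListAll.All (Holds N (lookup a ∘ lower)) xs)
        disjunctions [] = (⊥′ , atomic ⊥′) , (⊥′ , atomic ⊥′) , ⊥∉ p , ⊥∉ q , λ _ _ _ _ → []
        disjunctions (omitted χ χ∉ ∷ os) with disjunctions os
        ... | φ , ψ , φ∉p , ψ∉q , hold with χ∉
        ...   | inj₁ χ∉p = _ , ψ , ∨∉ p {χ} {φ} χ∉p φ∉p , ψ∉q , λ N a ¬χ∨φ ¬ψ →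
          refute N χ (¬χ∨φ ∘ inj₁) ∷ hold N a (¬χ∨φ ∘ inj₂) ¬ψ
        ...   | inj₂ χ∉q = φ , _ , φ∉p , ∨∉ q {χ} {ψ} χ∉q ψ∉q , λ N a ¬φ ¬χ∨ψ →
          refute N χ (¬χ∨ψ ∘ inj₁) ∷ hold N a ¬φ (¬χ∨ψ ∘ inj₂)

        -- Inseparability provides a type `r` containing neither disjunction. The image of its
        -- realization in an h-maximal model still realizes `r`, so satisfies neither.
        finitely-omitted : ∀ {xs} → ListAll.All Omitted xs → Realized Θ (List._∈ xs)
        finitely-omitted os with disjunctions os
        ... | φ , ψ , φ∉p , ψ∉q , hold
          with ¬¬-elim {P = Σ (S T n) λ r → φ ∉ formulas r × ψ ∉ formulas r}
          (λ ∄ → ¬sep (φ , ψ , φ∉p , ψ∉q , λ r → ¬¬-elim λ ¬φψ → ∄ (r , ¬φψ ∘ inj₁ , ¬φψ ∘ inj₂)))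
        ... | r , φ∉r , ψ∉r with consistent r
        ... | N , N⊨T , b , N⊩r with hMaximal-extension hT N N⊨T
        ... | M , M∈@(M⊨T , _) , f = M , to (proj₂ elementary M) M∈ , _ ,
          ListAll.lookup (hold M (map (fun f) b) (φ∉r ∘ M⊩r φ) (ψ∉r ∘ M⊩r ψ))
          where
          M⊩r : ∀ χ → M ⊨ proj₁ χ [ map (fun f) b ] → χ ∈ formulas r
          M⊩r = ⊩-complete r M⊨T λ {χ} χ∈r → hom-positive f (proj₂ χ) b (N⊩r χ∈r)

        common-restriction : Σ (Structure L) λ M → M ∈ HMaximal T × Σ (Vec (Carrier M) n) λ a →
          ∀ φ → M ⊨ proj₁ φ [ a ] → φ ∈ formulas p × φ ∈ formulas q
        common-restriction with compactness Θ Omitted finitely-omitted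
        ... | M , M⊨Θ , e , omits = M , from (proj₂ elementary M) M⊨Θ , _ , λ φ h →
          ¬¬-elim (λ φ∉p → lower (omits (omitted φ (inj₁ φ∉p)) h)) ,
          ¬¬-elim (λ φ∉q → lower (omits (omitted φ (inj₂ φ∉q)) h))

      -- Amalgamating realizations of the two types.

      hMaximal-realization : ∀ {n} (M : Structure L) (a : Vec (Carrier M) n) (p : S T n) →
        (∀ φ → M ⊨ proj₁ φ [ a ] → φ ∈ formulas p) →
        Σ (Structure L) λ N → N ∈ HMaximal T × Σ (Hom M N) λ f → N ⊩ p [ map (fun f) a ]
      hMaximal-realization M a p tp⊆p with extend-to-type M a p tp⊆p
      ... | N , N⊨T , f , N⊩p with hMaximal-extension hT N N⊨T
      ... | N′ , N′∈ , g = N′ , N′∈ , g ∘ₕ f , λ {φ} φ∈p →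
        subst (λ b → N′ ⊨ proj₁ φ [ b ]) (sym (map-∘ (fun g) (fun f) a))
          (hom-positive g (proj₂ φ) _ (N⊩p φ∈p))

      amalgamated : AmalgamationProperty (HMaximal T) →
        ∀ {n} (p q : S T n) {M} → M ∈ HMaximal T → (a : Vec (Carrier M) n) →
        (∀ φ → M ⊨ proj₁ φ [ a ] → φ ∈ formulas p × φ ∈ formulas q) →
        formulas p ≐ formulas q
      amalgamated ap p q {M} M∈ a tp⊆
        with hMaximal-realization M a p (λ φ → proj₁ ∘ tp⊆ φ)
           | hMaximal-realization M a q (λ φ → proj₂ ∘ tp⊆ φ)
      ... | B , B∈ , f , B⊩p | C , C∈ , g , C⊩q with ap M∈ B∈ C∈ f g
      ... | D , (D⊨T , _) , g′ , f′ , commutes =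
        (λ {φ} φ∈p → ⊩-complete q D⊨T D⊩q φ (D⊩p φ∈p)) ,
        (λ {φ} φ∈q → ⊩-complete p D⊨T D⊩p φ (D⊩q φ∈q))
        where
        open Structure D using (_≈_; domain)

        -- The square commutes only up to the equality of `D`, so the two images of `a` may differ
        -- as vectors; `⊨-resp` moves `q` from one to the other.
        agree : ∀ {k} (b : Vec (Carrier M) k) →
                Pointwise _≈_ (map (fun f′) (map (fun g) b)) (map (fun g′) (map (fun f) b))
        agree []      = []
        agree (x ∷ b) = Setoid.sym domain (commutes x) ∷ agree b

        D⊩p : D ⊩ p [ map (fun g′) (map (fun f) a) ]
        D⊩p {φ} φ∈p = hom-positive g′ (proj₂ φ) _ (B⊩p φ∈p)

        D⊩q : D ⊩ q [ map (fun g′) (map (fun f) a) ]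
        D⊩q {φ} φ∈q = ⊨-resp D (proj₁ φ) (agree a) (hom-positive f′ (proj₂ φ) _ (C⊩q φ∈q))

corollary3 : Classical → ∀ {ℓ} (L : Language ℓ) (T : Theory L) →
    HInductiveTheory T →
    Elementary (HMaximal T) →
    AmalgamationProperty (HMaximal T) →
    Hausdorff T
corollary3 classical L T hT elementary ap n p q p≢q
  with Classical.excludedMiddle classical {P = Separated classical p q}
... | yes sep = separated⇒disjoint classical p q sep
... | no ¬sep = let M , M∈ , a , tp⊆ = common-restriction classical hT elementary p q ¬sep in
  ⊥-elim (p≢q (amalgamated classical hT ap p q M∈ a tp⊆))
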